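{- Let $f:\{0,1\}^{2r+1}\to\{0,1\}$ be a binary one-dimensional radius-$r$ cellular automaton local rule such that, for some integer $m\ge 1$ and some function $\phi:\{0,1\}^{2mr+1}\to\{0,1\}$, either (a) $f^m(x_{ -m\lceil r\rceil},\dots,x_{m\lfloor r\rfloor})=x_0\cdot x_i\cdot\phi(x_{[-m\lceil r\rceil,m\lfloor r\rfloor]})$ with $i\in\{ -2,-1,1,2\}$; or (b) $f^m(x_{ -m\lceil r\rceil},\dots,x_{m\lfloor r\rfloor})=x_j\cdot x_{j+1}\cdot\phi(x_{[-m\lceil r\rceil,m\lfloor r\rfloor]})$ with $-\lceil r\rceil\le j\le\lfloor r\rfloor$. Suppose moreover that: - $f(0^{2r+1})=0$ and $f(1^{2r+1})=1$; - $\phi(1^{2mr+1})=1$; - $\phi(u_{mr})=0$ if $i\in\{ -2,2\}$, where $u_{mr}\in\{0,1\}^{2mr+1}$ is the block $u_s$ with $s=mr$ defined by $$u_s=\begin{cases}(10)^{\frac{s}{2}}\,1\,(01)^{\frac{s}{2}}, & s \text{ an even integer};\\ (01)^{\frac{s-1}{2}}\,010\,(10)^{\frac{s-1}{2}}, & s\text{ an odd integer};\\ (10)^{\frac{\lceil s\rceil}{2}}\,10\,(10)^{\frac{\lceil s\rceil}{2}-1}, & s\notin\mathbb{Z}\text{ and }\lceil s\rceil\text{ even};\\ (01)^{\frac{\lceil s\rceil-1}{2}}\,01\,(01)^{\frac{\lceil s\rceil-1}{2}}, & s\notin\mathbb{Z}\text{ and }\lceil s\rceil\text{ odd}.\end{cases}$$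 Then $f$ is a consensus rule and $\mathscr{B}^L_1=\{1^L\}$ for all $L\ge 2r+1$.
   Context: Here $r\in\{\tfrac12,1,\tfrac32,2,\dots\}$. A radius-$r$ (binary, one-dimensional) cellular automaton local rule is a function $f:\{0,1\}^{2r+1}\to\{0,1\}$ whose arguments are indexed by the integers $-\lceil r\rceil,\dots,\lfloor r\rfloor$; $x_{[a,b]}$ denotes $(x_a,x_{a+1},\dots,x_b)$. The identities (a), (b) are to hold for all values of the arguments, and the variables $x_i$, $x_j$, $x_{j+1}$ appearing in them are among the arguments of $f^m$. For a block $b$ of 0s and 1s, $b^n$ denotes the concatenation of $n$ copies of $b$; a block of length $2mr+1$ is fed to $\phi$ by reading its entries from left to right as the arguments with indices $-m\lceil r\rceil,\dots,m\lfloor r\rfloor$. A configuration of length $L$ is a cyclic word $c=(c_0,\dots,c_{L-1})\in\{0,1\}^L=:\mathscr{C}_L$, with cell indices taken modulo $L$. The global rule $F:\mathscr{C}_L\to\mathscr{C}_L$ induced by $f$ is $(F(c))_p=f(c_{p-\lceil r\rceil},\dots,c_p,\dots,c_{p+\lfloor r\rfloor})$; the same formula defines $F$ on bi-infinite configurations $c:\mathbb{Z}\to\{0,1\}$. $F^m$ is the $m$-th iterate, and $f^m:\{0,1\}^{2mr+1}\to\{0,1\}$ is its local rule, i.e. $(F^m(c))_p=f^m(c_{p-m\lceil r\rceil},\dots,c_{p+m\lfloor r\rfloor})$ for all bi-infinite $c$ and all $p$. An attractor of length $L$ of $F$ is a (nonempty) set $X\subseteq\mathscr{C}_L$ with $F(X)=X$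 such that any (nonempty) $Y\subseteq X$ with $F(Y)=Y$ equals $X$; if $X=\{x\}$ it is a fixed point and is identified with $x$. The basin of attraction of $X$ is $\{c\in\mathscr{C}_L: F^t(c)\in X\text{ for some }t\ge0\}$; $\mathscr{B}^L_x$ denotes the basin of attraction of $x^L$ for $x\in\{0,1\}$. The rule $f$ is a consensus rule if for every $L\ge 2r+1$ its only attractors of length $L$ are $0^L$ and $1^L$.
   Formalization: In case (a) with i=±2, if u_{mr} has entry 0 at index 0, φ is also assumed to vanish on the complement of u_{mr}; without this the claim is false (r=3/2, m=2, f=x_{ -2}x_0, φ=x_{ -4}: 1010 is a fixed point). -}

module Defs where

open import Data.Bool.Base using (Bool; true; false)
open import Data.Fin.Base as Fin using (fromℕ<; toℕ)
open import Data.Fin.Properties using (toℕ<n)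
open import Data.Integer.Base as ℤ using (ℤ; +_; -[1+_]; 0ℤ)
open import Data.Integer.DivMod using (_%ℕ_; n%ℕd<d)
import Data.Integer.Properties as ℤ
open import Data.Integer.Tactic.RingSolver using (solve-∀)
open import Data.List.Base as List using (List; []; _∷_; _++_; length)
import Data.List.Properties as List
open import Data.Nat.Base using (ℕ; zero; suc; _+_; _*_; _∸_; _≤_; _<_; z≤n; s≤s; s<s⁻¹; NonZero; ⌊_/2⌋; ⌈_/2⌉; parity)
import Data.Nat.Properties as ℕ
open import Data.Nat.GeneralisedArithmetic using (iterate)
open import Data.Nat.Tactic.RingSolver using () renaming (solve-∀ to solveℕ-∀)
open import Data.Parity.Base using (0ℙ; 1ℙ)
open import Data.Product.Base using (∃; _×_; _,_)
open import Data.Sum.Base using (_⊎_; inj₁; inj₂)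
open import Data.Vec.Base using (Vec; []; _∷_; lookup; tabulate; replicate; cast; fromList)
open import Data.Vec.Properties using (tabulate-cong)
open import Function.Bundles using (_⇔_)
open import Level using (0ℓ)
open import Relation.Binary.PropositionalEquality using (_≡_; refl; sym; trans; cong; cong₂; subst; module ≡-Reasoning)
open import Relation.Unary using (Pred; _∈_; _⊆_; _≐_; ｛_｝; Satisfiable)

pattern O = false
pattern I = true

-- The radius r ∈ {1/2, 1, 3/2, …} is represented by the natural number
-- 2r ≥ 1, so that ⌈r⌉ = ⌈ 2r /2⌉ and ⌊r⌋ = ⌊ 2r /2⌋.

Rule : ℕ → Set
Rule 2r = Vec Bool (suc 2r) → Bool

-- (c a , c (a + 1) , … , c (a + k - 1))
block : (ℤ → Bool) → ℤ → (k : ℕ) → Vec Bool k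
block c a k = tabulate λ j → c (a ℤ.+ + toℕ j)

periodic : ∀ {L} .{{_ : NonZero L}} → Vec Bool L → ℤ → Bool
periodic {L} c q = lookup c (fromℕ< (n%ℕd<d q L))

module _ {2r : ℕ} (f : Rule 2r) where

  globalℤ : (ℤ → Bool) → (ℤ → Bool)
  globalℤ c p = f (block c (p ℤ.- + ⌈ 2r /2⌉) (suc 2r))

  global : ∀ L .{{_ : NonZero L}} → Vec Bool L → Vec Bool L
  global L c = tabulate λ p → globalℤ (periodic c) (+ toℕ p)

-- Entry number q of a block (counted from 0), and 0 outside the block.
at : ∀ {k} → Vec Bool k → ℤ → Bool
at []       _         = O
at (b ∷ _)  (+ zero)  = b
at (_ ∷ bs) (+ suc q) = at bs (+ q)
at (_ ∷ _)  -[1+ _ ]  = O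

-- arg o x i is x_i, when the entries of x are indexed by -o, -o + 1, …
arg : ∀ {k} → ℕ → Vec Bool k → ℤ → Bool
arg o x i = at x (i ℤ.+ + o)

IsArg : (2r m : ℕ) → ℤ → Set
IsArg 2r m i = ℤ.- + (m * ⌈ 2r /2⌉) ℤ.≤ i × i ℤ.≤ + (m * ⌊ 2r /2⌋)

-- The local rule f^m of F^m: compute F^m at cell 0 of a configuration whose
-- cells -m⌈r⌉, …, m⌊r⌋ carry the arguments.  By power-local below, its other
-- cells are irrelevant and the result is indeed the local rule of F^m.
power : ∀ {2r} → Rule 2r → (m : ℕ) → Rule (m * 2r)
power {2r} f m x = iterate (globalℤ f) (arg (m * ⌈ 2r /2⌉) x) m 0ℤ

private
  Agree : (ℤ → Bool) → ℤ → (ℤ → Bool) → ℤ → ℕ → Set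
  Agree c a c′ a′ k = ∀ j → j < k → c (a ℤ.+ + j) ≡ c′ (a′ ℤ.+ + j)

  shift : ∀ a h j → a ℤ.+ h ℤ.+ j ℤ.- h ≡ a ℤ.+ j
  shift = solve-∀

  locality : ∀ {2r} (f : Rule 2r) m {c a c′ a′} →
             Agree c a c′ a′ (suc (m * 2r)) →
             iterate (globalℤ f) c  m (a  ℤ.+ + (m * ⌈ 2r /2⌉)) ≡
             iterate (globalℤ f) c′ m (a′ ℤ.+ + (m * ⌈ 2r /2⌉))
  locality f zero eq = eq 0 (s≤s z≤n)
  locality {2r} f (suc m) {c} {a} {c′} {a′} eq = begin
    iterate F (F c) m (a ℤ.+ + (h + m * h))          ≡⟨ cong (iterate F (F c) m) (assoc a) ⟩
    iterate F (F c) m (a ℤ.+ + h ℤ.+ + (m * h))      ≡⟨ locality f m {a = a ℤ.+ + h} {a′ = a′ ℤ.+ + h} step ⟩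
    iterate F (F c′) m (a′ ℤ.+ + h ℤ.+ + (m * h))    ≡⟨ cong (iterate F (F c′) m) (assoc a′) ⟨
    iterate F (F c′) m (a′ ℤ.+ + (h + m * h))        ∎
    where
    open ≡-Reasoning
    F = globalℤ f
    h = ⌈ 2r /2⌉
    assoc : ∀ b → b ℤ.+ + (h + m * h) ≡ b ℤ.+ + h ℤ.+ + (m * h)
    assoc b = trans (cong (λ z → b ℤ.+ z) (ℤ.pos-+ h (m * h))) (sym (ℤ.+-assoc b (+ h) (+ (m * h))))
    start : ∀ b j i → b ℤ.+ + h ℤ.+ + j ℤ.- + h ℤ.+ + i ≡ b ℤ.+ + (j + i)
    start b j i = trans (cong (λ z → z ℤ.+ + i) (shift b (+ h) (+ j)))
                 (trans (ℤ.+-assoc b (+ j) (+ i)) (cong (λ z → b ℤ.+ z) (sym (ℤ.pos-+ j i))))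
    bound : ∀ {j i} → j < suc (m * 2r) → i < suc 2r → j + i < suc (2r + m * 2r)
    bound {j} {i} (s≤s j≤) (s≤s i≤) = s≤s (subst (j + i ≤_) (ℕ.+-comm (m * 2r) 2r) (ℕ.+-mono-≤ j≤ i≤))
    step : Agree (F c) (a ℤ.+ + h) (F c′) (a′ ℤ.+ + h) (suc (m * 2r))
    step j j< = cong f (tabulate-cong λ i →
      trans (cong c (start a j (toℕ i)))
     (trans (eq (j + toℕ i) (bound j< (toℕ<n i)))
            (cong c′ (sym (start a′ j (toℕ i))))))

  at-tabulate : ∀ {k} (g : ℕ → Bool) j → j < k → at (tabulate {n = k} λ i → g (toℕ i)) (+ j) ≡ g j
  at-tabulate {suc k} g zero    _ = refl
  at-tabulate {suc k} g (suc j) j<k = at-tabulate (λ i → g (suc i)) j (s<s⁻¹ j<k)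

  cancel : ∀ o j → ℤ.- o ℤ.+ j ℤ.+ o ≡ j
  cancel = solve-∀

  recentre : ∀ p o → p ℤ.- o ℤ.+ o ≡ p
  recentre = solve-∀

power-local : ∀ {2r} (f : Rule 2r) m c p →
              iterate (globalℤ f) c m p ≡
              power f m (block c (p ℤ.- + (m * ⌈ 2r /2⌉)) (suc (m * 2r)))
power-local {2r} f m c p = begin
  iterate F c m p                          ≡⟨ cong (iterate F c m) (recentre p (+ o)) ⟨
  iterate F c m (p ℤ.- + o ℤ.+ + o)        ≡⟨ locality f m {a = p ℤ.- + o} {a′ = ℤ.- + o} agree ⟩
  iterate F (arg o x) m (ℤ.- + o ℤ.+ + o)  ≡⟨ cong (iterate F (arg o x) m) (ℤ.+-inverseˡ (+ o)) ⟩
  iterate F (arg o x) m 0ℤ                 ∎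
  where
  open ≡-Reasoning
  F = globalℤ f
  o = m * ⌈ 2r /2⌉
  x = block c (p ℤ.- + o) (suc (m * 2r))
  agree : Agree c (p ℤ.- + o) (arg o x) (ℤ.- + o) (suc (m * 2r))
  agree j j< = sym (trans (cong (at x) (cancel (+ o) (+ j)))
                          (at-tabulate (λ i → c (p ℤ.- + o ℤ.+ + i)) j j<))

infixr 8 _^ᵇ_
_^ᵇ_ : List Bool → ℕ → List Bool
b ^ᵇ n = List.concat (List.replicate n b)

private
  OI IO : List Bool
  OI = O ∷ I ∷ []
  IO = I ∷ O ∷ []

-- The block u_s as a function of 2s.
uList : ℕ → List Bool
uList 2s with parity 2s
uList 2s | 0ℙ with parity ⌊ 2s /2⌋
... | 0ℙ = let s = ⌊ 2s /2⌋ in IO ^ᵇ ⌊ s /2⌋ ++ I ∷ [] ++ OI ^ᵇ ⌊ s /2⌋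
... | 1ℙ = let s = ⌊ 2s /2⌋ in OI ^ᵇ ⌊ s ∸ 1 /2⌋ ++ O ∷ I ∷ O ∷ [] ++ IO ^ᵇ ⌊ s ∸ 1 /2⌋
uList 2s | 1ℙ with parity ⌈ 2s /2⌉
... | 0ℙ = let ⌈s⌉ = ⌈ 2s /2⌉ in IO ^ᵇ ⌊ ⌈s⌉ /2⌋ ++ IO ++ IO ^ᵇ (⌊ ⌈s⌉ /2⌋ ∸ 1)
... | 1ℙ = let ⌈s⌉ = ⌈ 2s /2⌉ in OI ^ᵇ ⌊ ⌈s⌉ ∸ 1 /2⌋ ++ OI ++ OI ^ᵇ ⌊ ⌈s⌉ ∸ 1 /2⌋

private
  length-^ : ∀ a b n → length ((a ∷ b ∷ []) ^ᵇ n) ≡ n + n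
  length-^ a b zero    = refl
  length-^ a b (suc n) = cong suc (trans (cong suc (length-^ a b n)) (sym (ℕ.+-suc n n)))

  length-++³ : ∀ (xs ys zs : List Bool) {i j k} → length xs ≡ i → length ys ≡ j → length zs ≡ k →
               length (xs ++ ys ++ zs) ≡ i + (j + k)
  length-++³ xs ys zs refl refl refl =
    trans (List.length-++ xs) (cong (λ z → length xs + z) (List.length-++ ys))

  half-even : ∀ n → parity n ≡ 0ℙ → ⌊ n /2⌋ + ⌊ n /2⌋ ≡ n
  half-even zero          _ = refl
  half-even (suc (suc n)) p = cong suc (trans (ℕ.+-suc _ _) (cong suc (half-even n p)))

  half-odd : ∀ n → parity n ≡ 1ℙ → suc (⌊ n ∸ 1 /2⌋ + ⌊ n ∸ 1 /2⌋) ≡ n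
  half-odd (suc zero)          _ = refl
  half-odd (suc (suc (suc n))) p = cong suc (cong suc (trans (ℕ.+-suc _ _) (half-odd (suc n) p)))

  half-up : ∀ n → parity n ≡ 1ℙ → ⌈ n /2⌉ + ⌈ n /2⌉ ≡ suc n
  half-up (suc zero)    _ = refl
  half-up (suc (suc n)) p = cong suc (trans (ℕ.+-suc _ _) (cong suc (half-up n p)))

  even-case : ∀ q → q + (1 + q) ≡ suc (q + q)
  even-case = solveℕ-∀

  odd-case : ∀ q → q + q + (3 + (q + q)) ≡ suc (suc (q + q) + suc (q + q))
  odd-case = solveℕ-∀

  half-even-case : ∀ q → q + q + (2 + ((q ∸ 1) + (q ∸ 1))) ≡ (q + q) + (q + q) ⊎ q ≡ 0
  half-even-case zero    = inj₂ refl
  half-even-case (suc q) = inj₁ (eq q)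
    where
    eq : ∀ q → suc q + suc q + (2 + (q + q)) ≡ (suc q + suc q) + (suc q + suc q)
    eq = solveℕ-∀

  half-odd-case : ∀ q → q + q + (2 + (q + q)) ≡ suc (q + q) + suc (q + q)
  half-odd-case = solveℕ-∀

length-u : ∀ 2s → length (uList 2s) ≡ suc 2s
length-u 2s with parity 2s in p
length-u 2s | 0ℙ with parity ⌊ 2s /2⌋ in q
... | 0ℙ = let s = ⌊ 2s /2⌋; t = ⌊ s /2⌋ in
  trans (length-++³ ((I ∷ O ∷ []) ^ᵇ t) (I ∷ []) _ (length-^ I O t) refl (length-^ O I t))
 (trans (even-case (t + t)) (cong suc (trans (cong₂ _+_ (half-even s q) (half-even s q)) (half-even 2s p))))
... | 1ℙ = let s = ⌊ 2s /2⌋; t = ⌊ s ∸ 1 /2⌋ in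
  trans (length-++³ ((O ∷ I ∷ []) ^ᵇ t) (O ∷ I ∷ O ∷ []) _ (length-^ O I t) refl (length-^ I O t))
 (trans (odd-case t) (cong suc (trans (cong₂ _+_ (half-odd s q) (half-odd s q)) (half-even 2s p))))
length-u 2s | 1ℙ with parity ⌈ 2s /2⌉ in q
... | 0ℙ with half-even-case ⌊ ⌈ 2s /2⌉ /2⌋
...   | inj₁ eq = let s = ⌈ 2s /2⌉; t = ⌊ s /2⌋ in
  trans (length-++³ ((I ∷ O ∷ []) ^ᵇ t) (I ∷ O ∷ []) _ (length-^ I O t) refl (length-^ I O (t ∸ 1)))
 (trans eq (trans (cong₂ _+_ (half-even s q) (half-even s q)) (half-up 2s p)))
...   | inj₂ eq with trans (sym (half-up 2s p)) (cong₂ _+_ z z)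
  where z : ⌈ 2s /2⌉ ≡ 0
        z = trans (sym (half-even ⌈ 2s /2⌉ q)) (cong₂ _+_ eq eq)
...     | ()
length-u 2s | 1ℙ | 1ℙ = let s = ⌈ 2s /2⌉; t = ⌊ s ∸ 1 /2⌋ in
  trans (length-++³ ((O ∷ I ∷ []) ^ᵇ t) (O ∷ I ∷ []) _ (length-^ O I t) refl (length-^ O I t))
 (trans (half-odd-case t) (trans (cong₂ _+_ (half-odd s q) (half-odd s q)) (half-up 2s p)))

-- u is an alternating block, meant to carry a 1 at index 0.  It does so as a
-- block of arguments of f^m when r is an integer or m = 1; but for half-integer
-- r and m ≡ 2, 3 (mod 4) the entry of u_{mr} at index 0 (entry number m⌈r⌉) is 0,
-- so that φ(u_{mr}) does not affect x₀·xᵢ·φ(x) at all.  Requiring only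
-- φ(u_{mr}) = 0 is then too weak: r = 3/2, m = 2, f(x₋₂,…,x₁) = x₋₂·x₀,
-- f²(x) = x₀·x₋₂·x₋₄, φ(x) = x₋₄, φ(u₃) = φ(0101010) = 0, yet every alternating
-- cyclic word is a fixed point of f.  In that situation the theorem therefore
-- also assumes φ = 0 at the other alternating block, map not u_{mr}.
u : (2s : ℕ) → Vec Bool (suc 2s)
u 2s = cast (length-u 2s) (fromList (uList 2s))

module _ {C : Set} (F : C → C) where

  Image : Pred C 0ℓ → Pred C 0ℓ
  Image X y = ∃ λ x → x ∈ X × F x ≡ y

  IsAttractor : Pred C 0ℓ → Set₁
  IsAttractor X =
    Satisfiable X × Image X ≐ X ×
    (∀ (Y : Pred C 0ℓ) → Satisfiable Y → Y ⊆ X → Image Y ≐ Y → Y ≐ X)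

  Basin : Pred C 0ℓ → Pred C 0ℓ
  Basin X c = ∃ λ t → iterate F c t ∈ X

IsConsensus : ∀ {2r} → Rule 2r → Set₁
IsConsensus {2r} f =
  ∀ L .{{_ : NonZero L}} → suc 2r ≤ L → (X : Pred (Vec Bool L) 0ℓ) →
  IsAttractor (global f L) X ⇔ (X ≐ ｛ replicate L O ｝ ⊎ X ≐ ｛ replicate L I ｝)

-- Let G = F^m.  By the assumed form of f^m, a zero of c at q forces zeros of G c
-- at q − a and q − a − d, where (a , d) = (0 , i) in case (a) and (j , 1) in
-- case (b).  Hence n steps produce zeros at q − n a − k d for 0 ≤ k ≤ n, and on a
-- cyclic word of length L the L-th iterate vanishes on the whole progression
-- q + ℤ d.  If d = ±1 this is everything.  If d = ±2, either the progression
-- q + 1 + ℤ d also contains a zero, and L further steps clear it too, or the word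
-- is alternating and the hypothesis on φ makes one more step produce 0^L.
-- So every word other than 1^L is eventually mapped to 0^L.

module Submission where

open import Defs
open import Data.Bool.Base using (Bool; not; _∧_)
open import Data.Bool.Properties using (∧-zeroʳ; not-involutive; ¬-not; _≟_)
open import Data.Fin.Base using (Fin; fromℕ<; toℕ)
open import Data.Fin.Properties using (any?; fromℕ<-cong; fromℕ<-toℕ; toℕ<n; toℕ-fromℕ<)
open import Data.Integer.Base using (ℤ; +≤+; +_; -[1+_]; -_; _-_; ∣_∣; _≤_; 0ℤ; 1ℤ) renaming (_+_ to _+ℤ_; _*_ to _*ℤ_)
open import Data.Integer.DivMod using (_%ℕ_; _/ℕ_; n%ℕd<d; a≡a%ℕn+[a/ℕn]*n)
import Data.Integer.Properties as ℤ
open import Data.Integer.Tactic.RingSolver using (solve-∀)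
open import Data.List.Base as List using (List; []; _∷_; _++_; length)
import Data.List.Properties as List
open import Data.Nat.Base using (ℕ; zero; suc; _+_; _*_; _∸_; _<_; _%_; z≤n; s≤s; s<s⁻¹; NonZero; ⌊_/2⌋; ⌈_/2⌉; parity) renaming (_≤_ to _≤ℕ_)
open import Data.Nat.DivMod using (m<n⇒m%n≡m; [m+kn]%n≡m%n)
open import Data.Nat.GeneralisedArithmetic using (iterate)
import Data.Nat.Properties as ℕ
open import Data.Parity.Base using (0ℙ; 1ℙ)
open import Data.Product.Base using (∃; _×_; _,_; proj₁; proj₂)
open import Data.Sum.Base using (_⊎_; inj₁; inj₂; [_,_]′)
open import Data.Vec.Base as Vec using (Vec; []; _∷_; lookup; tabulate; replicate; cast; fromList; map)
open import Data.Vec.Properties using (lookup∘tabulate; lookup-replicate; tabulate∘lookup; tabulate-cong)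
open import Function.Base using (_∘_)
open import Function.Bundles using (_⇔_; mk⇔)
open import Level using (0ℓ)
open import Relation.Binary.PropositionalEquality using (_≡_; _≢_; refl; sym; trans; cong; cong₂; subst; subst₂; module ≡-Reasoning)
open import Relation.Nullary using (yes; no; contradiction)
open import Relation.Unary using (Pred; _∈_; _⊆_; _≐_; ｛_｝)

-- Iterates of a map

iterate-+ : ∀ {A : Set} (h : A → A) x m n → iterate h (iterate h x m) n ≡ iterate h x (m + n)
iterate-+ h x zero    n = refl
iterate-+ h x (suc m) n = iterate-+ h (h x) m n

iterate-* : ∀ {A : Set} (h : A → A) x m n → iterate (λ y → iterate h y m) x n ≡ iterate h x (n * m)
iterate-* h x m zero    = refl
iterate-* h x m (suc n) = trans (iterate-* h (iterate h x m) m n) (iterate-+ h x m (n * m))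

iterate-preserves : ∀ {A : Set} (P : Pred A 0ℓ) {h : A → A} → (∀ {x} → P x → P (h x)) →
                    ∀ {x} n → P x → P (iterate h x n)
iterate-preserves P step zero    px = px
iterate-preserves P step (suc n) px = iterate-preserves P step n (step px)

iterate-fixed : ∀ {A : Set} {h : A → A} {x} → h x ≡ x → ∀ n → iterate h x n ≡ x
iterate-fixed {x = x} fix n = iterate-preserves (_≡ x) (λ { refl → fix }) n refl

-- Attractors and basins of a map with two fixed points

module _ {C : Set} {F : C → C} where

  singleton-attractor : ∀ {z} {X : Pred C 0ℓ} → F z ≡ z → X ≐ ｛ z ｝ → IsAttractor F X
  singleton-attractor {z} {X} fix (X⊆z , z⊆X) =
    (z , z⊆X refl) ,
    ((λ { (x , x∈X , refl) → z⊆X (trans (sym fix) (cong F (X⊆z x∈X))) }) ,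
     (λ y∈X → z , z⊆X refl , trans fix (X⊆z y∈X))) ,
    λ Y (y , y∈Y) Y⊆X _ →
      Y⊆X , λ x∈X → subst Y (trans (sym (X⊆z (Y⊆X y∈Y))) (X⊆z x∈X)) y∈Y

  -- Minimality is tested on the singleton of `z`, which is invariant because `z` is fixed.
  attractor-fixed : ∀ {z} {X : Pred C 0ℓ} → IsAttractor F X → F z ≡ z → z ∈ X → X ≐ ｛ z ｝
  attractor-fixed {z} {X} (_ , _ , minimal) fix z∈X
    with minimal ｛ z ｝ (z , refl) (λ { refl → z∈X })
           ((λ { (_ , refl , refl) → sym fix }) , λ { refl → z , refl , fix })
  ... | z⊆X , X⊆z = X⊆z , z⊆X

  module _ {z o : C} (z-fixed : F z ≡ z) (o-fixed : F o ≡ o)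
           (dichotomy : ∀ c → c ≡ o ⊎ ∃ λ t → iterate F c t ≡ z) where

    -- An attractor is closed under the map, so it contains the orbit of each of its points. By the
    -- dichotomy it therefore contains `o` or `z`, and an attractor containing a fixed point is that
    -- point alone.
    attractor⇔ : (X : Pred C 0ℓ) → IsAttractor F X ⇔ (X ≐ ｛ z ｝ ⊎ X ≐ ｛ o ｝)
    attractor⇔ X = mk⇔ to [ singleton-attractor z-fixed , singleton-attractor o-fixed ]′
      where
      to : IsAttractor F X → X ≐ ｛ z ｝ ⊎ X ≐ ｛ o ｝
      to attr@((x , x∈X) , (FX⊆X , _) , _) with dichotomy x
      ... | inj₁ refl       = inj₂ (attractor-fixed attr o-fixed x∈X)
      ... | inj₂ (t , refl) = inj₁ (attractor-fixed attr z-fixed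
                                      (iterate-preserves X (λ y∈X → FX⊆X (_ , y∈X , refl)) t x∈X))

    -- A point reaching `o` in `s` steps and `z` in `t` steps would be at both after `s + t` steps.
    basin≐ : z ≢ o → Basin F ｛ o ｝ ≐ ｛ o ｝
    basin≐ z≢o = to , λ { refl → 0 , refl }
      where
      to : Basin F ｛ o ｝ ⊆ ｛ o ｝
      to {c} (s , eq) with dichotomy c
      ... | inj₁ c≡o       = sym c≡o
      ... | inj₂ (t , eq′) = contradiction
        (begin
          z                           ≡⟨ iterate-fixed z-fixed s ⟨
          iterate F z s               ≡⟨ cong (λ y → iterate F y s) eq′ ⟨
          iterate F (iterate F c t) s ≡⟨ iterate-+ F c t s ⟩
          iterate F c (t + s)         ≡⟨ cong (iterate F c) (ℕ.+-comm t s) ⟩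
          iterate F c (s + t)         ≡⟨ iterate-+ F c s t ⟨
          iterate F (iterate F c s) t ≡⟨ cong (λ y → iterate F y t) eq ⟨
          iterate F o t               ≡⟨ iterate-fixed o-fixed t ⟩
          o                           ∎) z≢o
        where open ≡-Reasoning

-- Periodic configurations on ℤ and cyclic words

Periodic : ℕ → (ℤ → Bool) → Set
Periodic L c = ∀ p k → c (p +ℤ k *ℤ + L) ≡ c p

Vanishes : ((ℤ → Bool) → ℤ → Bool) → (ℤ → Bool) → Set
Vanishes G c = ∃ λ n → ∀ p → iterate G c n p ≡ O

-- This is what is retained of the product form of f^m: a zero of either factor suffices, whatever φ
-- is. The second factor is located by its distance `d` from the first, which becomes the difference
-- of the progression of zeros.
Erodes : ((ℤ → Bool) → ℤ → Bool) → ℤ → ℤ → Set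
Erodes G a d = ∀ c p → c (p +ℤ a) ≡ O ⊎ c (p +ℤ a +ℤ d) ≡ O → G c p ≡ O

vanishes-iterate : ∀ {G c} n → Vanishes G (iterate G c n) → Vanishes G c
vanishes-iterate {G} {c} n (t , eq) = n + t , λ p → trans (cong (λ x → x p) (sym (iterate-+ G c n t))) (eq p)

-- A natural multiple of L disappears on reduction modulo L; a negative one is made positive by
-- exchanging `r` and `s`.
remainder-unique : ∀ {L r s} .{{_ : NonZero L}} k → r < L → s < L → + r ≡ + s +ℤ k *ℤ + L → r ≡ s
remainder-unique {L} = go
  where
  nonneg : ∀ {r s} n → r < L → s < L → + r ≡ + s +ℤ + n *ℤ + L → r ≡ s
  nonneg {r} {s} n r<L s<L eq = begin
    r               ≡⟨ m<n⇒m%n≡m r<L ⟨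
    r % L           ≡⟨ cong (_% L) (ℤ.+-injective (trans eq (trans (cong (+ s +ℤ_) (sym (ℤ.pos-* n L))) (sym (ℤ.pos-+ s (n * L)))))) ⟩
    (s + n * L) % L ≡⟨ [m+kn]%n≡m%n s n L ⟩
    s % L           ≡⟨ m<n⇒m%n≡m s<L ⟩
    s               ∎
    where open ≡-Reasoning
  swap : ∀ s k L → s ≡ (s +ℤ k *ℤ L) +ℤ (- k) *ℤ L
  swap = solve-∀
  go : ∀ {r s} k → r < L → s < L → + r ≡ + s +ℤ k *ℤ + L → r ≡ s
  go (+ n)        r<L s<L eq = nonneg n r<L s<L eq
  go {s = s} -[1+ n ] r<L s<L eq = sym (nonneg (suc n) s<L r<L
    (trans (swap (+ s) -[1+ n ] (+ L)) (cong (_+ℤ + suc n *ℤ + L) (sym eq))))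

module _ {L : ℕ} .{{_ : NonZero L}} where

  at-remainder : ∀ {c} → Periodic L c → ∀ p → c p ≡ c (+ (p %ℕ L))
  at-remainder {c} per p = trans (cong c (a≡a%ℕn+[a/ℕn]*n p L)) (per (+ (p %ℕ L)) (p /ℕ L))

  -- By periodicity a finite search through the L residues decides the question for all of ℤ.
  all-or-zero : ∀ {c} → Periodic L c → (∀ p → c p ≡ I) ⊎ ∃ λ p → c p ≡ O
  all-or-zero {c} per with any? (λ (i : Fin L) → c (+ toℕ i) ≟ O)
  ... | yes (i , eq) = inj₂ (+ toℕ i , eq)
  ... | no  none     = inj₁ λ p → ¬-not λ eq → none
          (fromℕ< (n%ℕd<d p L) ,
           trans (cong (c ∘ +_) (toℕ-fromℕ< (n%ℕd<d p L))) (trans (sym (at-remainder per p)) eq))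

  -- The two remainders differ by a multiple of L and hence coincide; `rearrange` eliminates `p`
  -- from the two division equations.
  periodic-periodic : (c : Vec Bool L) → Periodic L (periodic c)
  periodic-periodic c p k = cong (lookup c) (fromℕ<-cong _ _
    (remainder-unique (p /ℕ L +ℤ k - (p +ℤ k *ℤ + L) /ℕ L) (n%ℕd<d (p +ℤ k *ℤ + L) L) (n%ℕd<d p L)
      (rearrange (+ L) (+ ((p +ℤ k *ℤ + L) %ℕ L)) (+ (p %ℕ L)) ((p +ℤ k *ℤ + L) /ℕ L) (p /ℕ L) k
        (a≡a%ℕn+[a/ℕn]*n (p +ℤ k *ℤ + L) L) (a≡a%ℕn+[a/ℕn]*n p L))) _ _)
    where
    isolate : ∀ r q L → r ≡ r +ℤ q *ℤ L - q *ℤ L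
    isolate = solve-∀
    collect : ∀ s t k q L → s +ℤ t *ℤ L +ℤ k *ℤ L - q *ℤ L ≡ s +ℤ (t +ℤ k - q) *ℤ L
    collect = solve-∀
    rearrange : ∀ L r s q t k {p} → p +ℤ k *ℤ L ≡ r +ℤ q *ℤ L → p ≡ s +ℤ t *ℤ L →
                r ≡ s +ℤ (t +ℤ k - q) *ℤ L
    rearrange L r s q t k eq refl = trans (isolate r q L)
      (trans (cong (_- q *ℤ L) (sym eq)) (collect s t k q L))

  periodic-toℕ : (c : Vec Bool L) (i : Fin L) → periodic c (+ toℕ i) ≡ lookup c i
  periodic-toℕ c i = cong (lookup c)
    (trans (fromℕ<-cong _ _ (m<n⇒m%n≡m (toℕ<n i)) _ (toℕ<n i)) (fromℕ<-toℕ i (toℕ<n i)))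

tabulate-const : ∀ {A : Set} {n} {g : Fin n → A} {b} → (∀ i → g i ≡ b) → tabulate g ≡ replicate n b
tabulate-const {n = n} {b = b} eq = trans
  (tabulate-cong λ i → trans (eq i) (sym (lookup-replicate i b))) (tabulate∘lookup (replicate n b))

periodic-const : ∀ {L} .{{_ : NonZero L}} {c : Vec Bool L} {b} → (∀ p → periodic c p ≡ b) → c ≡ replicate L b
periodic-const {c = c} eq = trans (sym (tabulate∘lookup c))
  (tabulate-const λ i → trans (sym (periodic-toℕ c i)) (eq (+ toℕ i)))

-- The global rule on ℤ and on cyclic words

module _ {2r : ℕ} (f : Rule 2r) where

  -- Configurations on ℤ are functions and are compared only pointwise, so the global rule has to be
  -- shown to respect this equality.
  globalℤ-cong : ∀ {c c′} → (∀ p → c p ≡ c′ p) → ∀ p → globalℤ f c p ≡ globalℤ f c′ p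
  globalℤ-cong eq p = cong f (tabulate-cong λ j → eq (p - + ⌈ 2r /2⌉ +ℤ + toℕ j))

  iterate-globalℤ-cong : ∀ {c c′} t → (∀ p → c p ≡ c′ p) →
                         ∀ p → iterate (globalℤ f) c t p ≡ iterate (globalℤ f) c′ t p
  iterate-globalℤ-cong zero    eq = eq
  iterate-globalℤ-cong (suc t) eq = iterate-globalℤ-cong t (globalℤ-cong eq)

  globalℤ-periodic : ∀ {L c} → Periodic L c → Periodic L (globalℤ f c)
  globalℤ-periodic {L} {c} per p k = cong f (tabulate-cong λ j →
    trans (cong c (shuffle p k (+ L) (+ ⌈ 2r /2⌉) (+ toℕ j))) (per (p - + ⌈ 2r /2⌉ +ℤ + toℕ j) k))
    where
    shuffle : ∀ p k L h j → p +ℤ k *ℤ L - h +ℤ j ≡ p - h +ℤ j +ℤ k *ℤ L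
    shuffle = solve-∀

  module _ {L : ℕ} .{{_ : NonZero L}} where

    -- `global` evaluates the rule only at the cells 0, ..., L - 1; periodicity of the image carries
    -- the equation to every `p`.
    periodic-global : ∀ c p → periodic (global f L c) p ≡ globalℤ f (periodic c) p
    periodic-global c p = begin
      periodic (global f L c) p                                   ≡⟨ lookup∘tabulate _ (fromℕ< p%L<L) ⟩
      globalℤ f (periodic c) (+ toℕ (fromℕ< p%L<L))               ≡⟨ cong (globalℤ f (periodic c) ∘ +_) (toℕ-fromℕ< p%L<L) ⟩
      globalℤ f (periodic c) (+ (p %ℕ L))                         ≡⟨ at-remainder (globalℤ-periodic (periodic-periodic c)) p ⟨
      globalℤ f (periodic c) p                                    ∎
      where
      open ≡-Reasoning
      p%L<L = n%ℕd<d p L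

    periodic-iterate : ∀ t c p → periodic (iterate (global f L) c t) p ≡ iterate (globalℤ f) (periodic c) t p
    periodic-iterate zero    c p = refl
    periodic-iterate (suc t) c p = trans (periodic-iterate t (global f L c) p)
      (iterate-globalℤ-cong t (periodic-global c) p)

    global-replicate : ∀ {b} → f (replicate (suc 2r) b) ≡ b → global f L (replicate L b) ≡ replicate L b
    global-replicate {b} eq = tabulate-const λ i → trans
      (cong f (tabulate-const λ j → lookup-replicate (fromℕ< (n%ℕd<d (+ toℕ i - + ⌈ 2r /2⌉ +ℤ + toℕ j) L)) b)) eq

-- Spreading of zeros

module _ {L : ℕ} .{{_ : NonZero L}} {G : (ℤ → Bool) → ℤ → Bool}
         (G-periodic : ∀ {c} → Periodic L c → Periodic L (G c)) where

  -- One zero is followed: each step displaces it by -a or, through the second factor, by -a - d.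
  -- Here the first `k` of the `n` steps use the second factor and the others the first.
  erode : ∀ {a d} → Erodes G a d → ∀ n k {c q} → k ≤ℕ n → c q ≡ O →
          iterate G c n (q - + n *ℤ a - + k *ℤ d) ≡ O
  erode {a} {d} er zero zero {c} {q} _ eq = trans (cong c (origin q a d)) eq
    where
    origin : ∀ q a d → q - 0ℤ *ℤ a - 0ℤ *ℤ d ≡ q
    origin = solve-∀
  erode {a} {d} er (suc n) zero {c} {q} _ eq = trans
    (cong (iterate G (G c) n) (move q a d (+ n)))
    (erode er n zero z≤n (er c (q - a) (inj₁ (trans (cong c (back q a)) eq))))
    where
    move : ∀ q a d n → q - (1ℤ +ℤ n) *ℤ a - 0ℤ *ℤ d ≡ q - a - n *ℤ a - 0ℤ *ℤ d
    move = solve-∀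
    back : ∀ q a → q - a +ℤ a ≡ q
    back = solve-∀
  erode {a} {d} er (suc n) (suc k) {c} {q} (s≤s k≤n) eq = trans
    (cong (iterate G (G c) n) (move q a d (+ n) (+ k)))
    (erode er n k k≤n (er c (q - a - d) (inj₂ (trans (cong c (back q a d)) eq))))
    where
    move : ∀ q a d n k → q - (1ℤ +ℤ n) *ℤ a - (1ℤ +ℤ k) *ℤ d ≡ q - a - d - n *ℤ a - k *ℤ d
    move = solve-∀
    back : ∀ q a d → q - a - d +ℤ a +ℤ d ≡ q
    back = solve-∀

  -- Modulo L the drift -La disappears, and the index counts only through a remainder, which L steps
  -- are enough to reach.
  sweep : ∀ {a d} → Erodes G a d → ∀ {c} → Periodic L c → ∀ {q} → c q ≡ O →
          ∀ k → iterate G c L (q +ℤ k *ℤ d) ≡ O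
  -- Zeros travel by -d, so -k is what is divided by L. The remainder `s` counts the steps through
  -- the second factor; the quotient `t` is absorbed by the period.
  sweep {a} {d} er {c} per {q} eq k = trans (cong (iterate G c L) (split q a d (+ L) (+ s) t (a≡a%ℕn+[a/ℕn]*n (- k) L)))
    (trans (iterate-preserves (Periodic L) G-periodic L per (q - + L *ℤ a - + s *ℤ d) (a - t *ℤ d))
           (erode er L s (ℕ.<⇒≤ (n%ℕd<d (- k) L)) eq))
    where
    s = (- k) %ℕ L
    t = (- k) /ℕ L
    expand : ∀ q a d L s t → q - (s +ℤ t *ℤ L) *ℤ d ≡ q - L *ℤ a - s *ℤ d +ℤ (a - t *ℤ d) *ℤ L
    expand = solve-∀
    double-neg : ∀ q k d → q +ℤ k *ℤ d ≡ q - (- k) *ℤ d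
    double-neg = solve-∀
    split : ∀ q a d L s t → - k ≡ s +ℤ t *ℤ L →
            q +ℤ k *ℤ d ≡ q - L *ℤ a - s *ℤ d +ℤ (a - t *ℤ d) *ℤ L
    split q a d L s t -k≡ = trans (double-neg q k d)
      (trans (cong (λ x → q - x *ℤ d) -k≡) (expand q a d L s t))

  -- The equation makes `d` its own inverse, so the progression through `q` is all of ℤ.
  vanishes-unit : ∀ {a} d → Erodes G a d → d *ℤ d ≡ 1ℤ →
                  ∀ {c} → Periodic L c → ∀ {q} → c q ≡ O → Vanishes G c
  vanishes-unit d er dd≡1 {c} per {q} eq = L , λ p →
    trans (cong (iterate G c L) (reach p)) (sweep er per eq ((p - q) *ℤ d))
    where
    one : ∀ p q → p ≡ q +ℤ (p - q) *ℤ 1ℤ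
    one = solve-∀
    reach : ∀ p → p ≡ q +ℤ (p - q) *ℤ d *ℤ d
    reach p = trans (one p q) (cong (q +ℤ_) (trans (cong ((p - q) *ℤ_) (sym dd≡1)) (sym (ℤ.*-assoc (p - q) d d))))

  -- The relation between `e` and `d` treats d = 2 and d = -2 together: every even displacement is a
  -- multiple of `d`. The parity of L needs no separate treatment: for d = ±2 and odd L the two
  -- progressions coincide modulo L, and the search finds a zero.
  vanishes-double : ∀ {a} d e → Erodes G a d → e *ℤ d ≡ + 2 →
                    (∀ {c} → (∀ p → c (p +ℤ 1ℤ) ≡ not (c p)) → ∀ p → G c p ≡ O) →
                    ∀ {c} → Periodic L c → ∀ {q} → c q ≡ O → Vanishes G c
  vanishes-double d e er ed≡2 alternating {c} per {q} eq = conclude (all-or-zero sublattice-periodic)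
    where
    c₁ = iterate G c L
    c₁-periodic : Periodic L c₁
    c₁-periodic = iterate-preserves (Periodic L) G-periodic L per
    c₁-zero : ∀ k → c₁ (q +ℤ k *ℤ d) ≡ O
    c₁-zero = sweep er per eq

    -- Moving the index by L moves the cell by Ld, so this sequence of indices also has period L and
    -- can be searched for a zero.
    sublattice-periodic : Periodic L (λ k → c₁ (q +ℤ 1ℤ +ℤ k *ℤ d))
    sublattice-periodic k l = trans (cong c₁ (scale q k l (+ L) d)) (c₁-periodic (q +ℤ 1ℤ +ℤ k *ℤ d) (l *ℤ d))
      where
      scale : ∀ q k l L d → q +ℤ 1ℤ +ℤ (k +ℤ l *ℤ L) *ℤ d ≡ q +ℤ 1ℤ +ℤ k *ℤ d +ℤ l *ℤ d *ℤ L
      scale = solve-∀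

    shift : ∀ x t → x +ℤ t *ℤ + 2 ≡ x +ℤ t *ℤ e *ℤ d
    shift x t = cong (x +ℤ_) (trans (cong (t *ℤ_) (sym ed≡2)) (sym (ℤ.*-assoc t e d)))

    restore : ∀ p q → p ≡ q +ℤ (p - q)
    restore = solve-∀

    data Reach (p : ℤ) : Set where
      even : ∀ k → p ≡ q +ℤ k *ℤ d → Reach p
      odd  : ∀ k → p ≡ q +ℤ 1ℤ +ℤ k *ℤ d → Reach p

    reach : ∀ p → Reach p
    reach p with (p - q) %ℕ 2 | (p - q) /ℕ 2 | a≡a%ℕn+[a/ℕn]*n (p - q) 2 | n%ℕd<d (p - q) 2
    ... | 0           | t | p-q≡ | _ = even (t *ℤ e)
      (trans (restore p q) (trans (cong (q +ℤ_) p-q≡) (trans (assoc₀ q t) (shift q t))))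
      where
      assoc₀ : ∀ q t → q +ℤ (0ℤ +ℤ t *ℤ + 2) ≡ q +ℤ t *ℤ + 2
      assoc₀ = solve-∀
    ... | 1           | t | p-q≡ | _ = odd (t *ℤ e)
      (trans (restore p q) (trans (cong (q +ℤ_) p-q≡) (trans (assoc₁ q t) (shift (q +ℤ 1ℤ) t))))
      where
      assoc₁ : ∀ q t → q +ℤ (1ℤ +ℤ t *ℤ + 2) ≡ q +ℤ 1ℤ +ℤ t *ℤ + 2
      assoc₁ = solve-∀
    ... | suc (suc _) | _ | _    | s≤s (s≤s ())

    conclude : ((∀ k → c₁ (q +ℤ 1ℤ +ℤ k *ℤ d) ≡ I) ⊎ ∃ λ k → c₁ (q +ℤ 1ℤ +ℤ k *ℤ d) ≡ O) → Vanishes G c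
    conclude (inj₁ ones) = vanishes-iterate L (1 , alternating alternates)
      where
      alternates : ∀ p → c₁ (p +ℤ 1ℤ) ≡ not (c₁ p)
      alternates p with reach p
      ... | even k refl = trans (cong c₁ (swap q (k *ℤ d))) (trans (ones k) (cong not (sym (c₁-zero k))))
        where
        swap : ∀ q x → q +ℤ x +ℤ 1ℤ ≡ q +ℤ 1ℤ +ℤ x
        swap = solve-∀
      -- The right neighbour of a cell of the second progression is two cells beyond a cell of the
      -- first, that is, `e` indices further in the first.
      ... | odd k refl = trans (cong c₁ (trans (carry q k d) (trans (cong (λ x → q +ℤ k *ℤ d +ℤ x) (sym ed≡2)) (collect q k e d))))
                               (trans (c₁-zero (k +ℤ e)) (cong not (sym (ones k))))
        where
        carry : ∀ q k d → q +ℤ 1ℤ +ℤ k *ℤ d +ℤ 1ℤ ≡ q +ℤ k *ℤ d +ℤ + 2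
        carry = solve-∀
        collect : ∀ q k e d → q +ℤ k *ℤ d +ℤ e *ℤ d ≡ q +ℤ (k +ℤ e) *ℤ d
        collect = solve-∀
    conclude (inj₂ (k₀ , zero₁)) = vanishes-iterate L (L , zero₂)
      where
      rebase : ∀ q k k₀ d → q +ℤ k *ℤ d ≡ q +ℤ k₀ *ℤ d +ℤ (k - k₀) *ℤ d
      rebase = solve-∀
      zero₂ : ∀ p → iterate G c₁ L p ≡ O
      zero₂ p with reach p
      -- The first progression must vanish after the additional L steps too, so it is swept anew
      -- from its member of index 0.
      ... | even k refl = trans (cong (iterate G c₁ L) (rebase q k 0ℤ d)) (sweep er c₁-periodic (c₁-zero 0ℤ) (k - 0ℤ))
      ... | odd  k refl = trans (cong (iterate G c₁ L) (rebase (q +ℤ 1ℤ) k k₀ d)) (sweep er c₁-periodic zero₁ (k - k₀))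

-- The dichotomy for cyclic words

module _ {L : ℕ} .{{_ : NonZero L}} {2r : ℕ} (f : Rule 2r)
         (vanishes : ∀ {c} → Periodic L c → ∀ {q} → c q ≡ O → Vanishes (globalℤ f) c) where

  global-dichotomy : ∀ c → c ≡ replicate L I ⊎ ∃ λ t → iterate (global f L) c t ≡ replicate L O
  global-dichotomy c with all-or-zero (periodic-periodic c)
  ... | inj₁ ones     = inj₁ (periodic-const ones)
  ... | inj₂ (q , eq) with vanishes (periodic-periodic c) {q} eq
  ...   | t , zeros = inj₂ (t , periodic-const λ p → trans (periodic-iterate f t c p) (zeros p))

replicate-O≢I : ∀ L .{{_ : NonZero L}} → replicate L O ≢ replicate L I
replicate-O≢I (suc L) ()

-- Alternating blocks and the block u

Alternating : Bool → List Bool → Set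
Alternating b xs = ∃ λ k → xs ≡ List.iterate not b k

∷-alternating : ∀ {b xs} → Alternating (not b) xs → Alternating b (b ∷ xs)
∷-alternating {b} (k , refl) = suc k , refl

-- A prefix of even length leads back to the starting letter, so `xs` has to start with `b` as well.
^ᵇ-alternating : ∀ b n {xs} → Alternating b xs → Alternating b ((b ∷ not b ∷ []) ^ᵇ n ++ xs)
^ᵇ-alternating b zero    alt = alt
^ᵇ-alternating b (suc n) {xs} alt = ∷-alternating (∷-alternating
  (subst (λ b′ → Alternating b′ ((b ∷ not b ∷ []) ^ᵇ n ++ xs)) (sym (not-involutive b)) (^ᵇ-alternating b n alt)))

^ᵇ-alternating-[] : ∀ b n → Alternating b ((b ∷ not b ∷ []) ^ᵇ n)
^ᵇ-alternating-[] b n = subst (Alternating b) (List.++-identityʳ _) (^ᵇ-alternating b n (0 , refl))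

-- The witness is the first letter in each of the four cases: 1 when ⌈s⌉ is even, 0 when it is odd.
uList-alternating : ∀ n → ∃ λ b → Alternating b (uList n)
uList-alternating n with parity n
uList-alternating n | 0ℙ with parity ⌊ n /2⌋
... | 0ℙ = let t = ⌊ ⌊ n /2⌋ /2⌋ in
  I , ^ᵇ-alternating I t (∷-alternating (^ᵇ-alternating-[] O t))
... | 1ℙ = let t = ⌊ ⌊ n /2⌋ ∸ 1 /2⌋ in
  O , ^ᵇ-alternating O t (∷-alternating (∷-alternating (∷-alternating (^ᵇ-alternating-[] I t))))
uList-alternating n | 1ℙ with parity ⌈ n /2⌉
... | 0ℙ = let t = ⌊ ⌈ n /2⌉ /2⌋ in
  I , ^ᵇ-alternating I t (∷-alternating (∷-alternating (^ᵇ-alternating-[] I (t ∸ 1))))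
... | 1ℙ = let t = ⌊ ⌈ n /2⌉ ∸ 1 /2⌋ in
  O , ^ᵇ-alternating O t (∷-alternating (∷-alternating (^ᵇ-alternating-[] O t)))

-- The length left open in `Alternating` is matched here with the vector index; leaving it open lets
-- the pieces of `uList` be joined without counting letters.
cast-iterate : ∀ b k {n} {xs : List Bool} (eq : length xs ≡ n) → xs ≡ List.iterate not b k →
               cast eq (fromList xs) ≡ Vec.iterate not b n
cast-iterate b zero    {zero}  eq refl = refl
cast-iterate b (suc k) {suc n} eq refl = cong (b ∷_) (cast-iterate (not b) k (ℕ.suc-injective eq) refl)

u-alternating : ∀ n → ∃ λ b → u n ≡ Vec.iterate not b (suc n)
u-alternating n with uList-alternating n
... | b , k , eq = b , cast-iterate b k (length-u n) eq

map-not-iterate : ∀ b n → map not (Vec.iterate not b n) ≡ Vec.iterate not (not b) n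
map-not-iterate b zero    = refl
map-not-iterate b (suc n) = cong (not b ∷_) (map-not-iterate (not b) n)

tabulate-alternating : ∀ n (g : ℕ → Bool) → (∀ j → g (suc j) ≡ not (g j)) →
                       tabulate {n = n} (g ∘ toℕ) ≡ Vec.iterate not (g 0) n
tabulate-alternating zero    g alt = refl
tabulate-alternating (suc n) g alt = cong (g 0 ∷_) (trans (tabulate-alternating n (g ∘ suc) (alt ∘ suc))
  (cong (λ b → Vec.iterate not b n) (alt 0)))

block-alternating : ∀ {c} → (∀ p → c (p +ℤ 1ℤ) ≡ not (c p)) →
                    ∀ a n → ∃ λ b → block c a n ≡ Vec.iterate not b n
block-alternating {c} alt a n = c (a +ℤ 0ℤ) ,
  tabulate-alternating n (λ j → c (a +ℤ + j)) λ j → trans (cong c (next a (+ j))) (alt (a +ℤ + j))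
  where
  next : ∀ a j → a +ℤ (1ℤ +ℤ j) ≡ a +ℤ j +ℤ 1ℤ
  next = solve-∀

at-tabulate : ∀ {k} (g : ℕ → Bool) j → j < k → at (tabulate {n = k} (g ∘ toℕ)) (+ j) ≡ g j
at-tabulate {suc k} g zero    _   = refl
at-tabulate {suc k} g (suc j) j<k = at-tabulate (g ∘ suc) j (s<s⁻¹ j<k)

at-map-not : ∀ {k} (v : Vec Bool k) j → j < k → at (map not v) (+ j) ≡ not (at v (+ j))
at-map-not (b ∷ v) zero    _   = refl
at-map-not (b ∷ v) (suc j) j<k = at-map-not v j (s<s⁻¹ j<k)

∧-zero₂ : ∀ {x y} z → x ≡ O ⊎ y ≡ O → x ∧ y ∧ z ≡ O
∧-zero₂     z (inj₁ refl) = refl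
∧-zero₂ {x} z (inj₂ refl) = ∧-zeroʳ x

-- The local rule of F^m and its product form

module _ {2r : ℕ} (m : ℕ) where

  private
    o = m * ⌈ 2r /2⌉

  o≤m*2r : o ≤ℕ m * 2r
  o≤m*2r = ℕ.*-monoʳ-≤ m (ℕ.⌈n/2⌉≤n 2r)

  IsArg-0 : IsArg 2r m 0ℤ
  IsArg-0 = ℤ.neg-mono-≤ (+≤+ (z≤n {o})) , +≤+ z≤n

  -- Adding m⌈r⌉ to the bounds on `i` gives 0 and 2mr, because ⌊r⌋ + ⌈r⌉ = 2r.
  arg-position : ∀ {i} → IsArg 2r m i → ∃ λ j → i +ℤ + o ≡ + j × j < suc (m * 2r)
  arg-position {i} (-o≤i , i≤) = ∣ i +ℤ + o ∣ , sym nonneg ,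
    s≤s (ℤ.drop‿+≤+ (subst₂ _≤_ (sym nonneg) total (ℤ.+-monoˡ-≤ (+ o) i≤)))
    where
    nonneg : + ∣ i +ℤ + o ∣ ≡ i +ℤ + o
    nonneg = ℤ.0≤i⇒+∣i∣≡i (subst (_≤ i +ℤ + o) (ℤ.+-inverseˡ (+ o)) (ℤ.+-monoˡ-≤ (+ o) -o≤i))
    total : + (m * ⌊ 2r /2⌋) +ℤ + o ≡ + (m * 2r)
    total = trans (sym (ℤ.pos-+ (m * ⌊ 2r /2⌋) o)) (cong +_
      (trans (sym (ℕ.*-distribˡ-+ m ⌊ 2r /2⌋ ⌈ 2r /2⌉)) (cong (m *_) (ℕ.⌊n/2⌋+⌈n/2⌉≡n 2r))))

  arg-block : ∀ c p {i} → IsArg 2r m i → arg o (block c (p - + o) (suc (m * 2r))) i ≡ c (p +ℤ i)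
  arg-block c p {i} isArg with arg-position isArg
  ... | j , i+o≡j , j< = trans (cong (at (block c (p - + o) (suc (m * 2r)))) i+o≡j)
    (trans (at-tabulate (λ j → c (p - + o +ℤ + j)) j j<)
           (cong c (trans (cong (p - + o +ℤ_) (sym i+o≡j)) (cancel p (+ o) i))))
    where
    cancel : ∀ p o i → p - o +ℤ (i +ℤ o) ≡ p +ℤ i
    cancel = solve-∀

  -- Only two alternating blocks of a given length exist, u and its complement. If `x` is the
  -- complement, its 1 at index 0 is a 0 of u there, which is the condition in the added hypothesis
  -- on φ.
  alternating-with-1 : ∀ {b} (x : Vec Bool (suc (m * 2r))) → x ≡ Vec.iterate not b (suc (m * 2r)) →
                       arg o x 0ℤ ≡ I →
                       x ≡ u (m * 2r) ⊎ x ≡ map not (u (m * 2r)) × arg o (u (m * 2r)) 0ℤ ≡ O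
  alternating-with-1 {b} x x≡ x₀≡I with u-alternating (m * 2r)
  ... | b′ , u≡ with b ≟ b′
  ... | yes refl = inj₁ (trans x≡ (sym u≡))
  ... | no b≢b′ = inj₂ (x≡map ,
          trans (sym (not-involutive _)) (cong not (trans (sym (at-map-not (u (m * 2r)) o (s≤s o≤m*2r)))
            (trans (cong (λ y → arg o y 0ℤ) (sym x≡map)) x₀≡I))))
    where
    x≡map : x ≡ map not (u (m * 2r))
    x≡map = trans x≡ (trans (cong (λ b″ → Vec.iterate not b″ (suc (m * 2r))) (¬-not b≢b′))
      (trans (sym (map-not-iterate b′ (suc (m * 2r)))) (cong (map not) (sym u≡))))

  module _ (f : Rule 2r) (φ : Vec Bool (suc (m * 2r)) → Bool) where

    private
      G : (ℤ → Bool) → ℤ → Bool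
      G c = iterate (globalℤ f) c m

    G-periodic : ∀ {L c} → Periodic L c → Periodic L (G c)
    G-periodic {L} = iterate-preserves (Periodic L) (λ {c} → globalℤ-periodic f {c = c}) m

    vanishes-power : ∀ {c} → Vanishes G c → Vanishes (globalℤ f) c
    vanishes-power {c} (n , zeros) = n * m , λ p →
      trans (cong (λ x → x p) (sym (iterate-* (globalℤ f) c m n))) (zeros p)

    module _ {i j : ℤ} (i-arg : IsArg 2r m i) (j-arg : IsArg 2r m j)
             (form : ∀ x → power f m x ≡ arg o x i ∧ arg o x j ∧ φ x) where

      -- The assumed identity speaks of cell 0 only; `power-local` transports it to every cell `p`.
      G-form : ∀ c p → G c p ≡ c (p +ℤ i) ∧ c (p +ℤ j) ∧ φ (block c (p - + o) (suc (m * 2r)))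
      G-form c p = trans (power-local f m c p) (trans (form x)
        (cong₂ (λ a b → a ∧ b ∧ φ x) (arg-block c p i-arg) (arg-block c p j-arg)))
        where x = block c (p - + o) (suc (m * 2r))

      G-erodes : ∀ d → i +ℤ d ≡ j → Erodes G i d
      G-erodes d refl c p zeros = trans (G-form c p)
        (∧-zero₂ _ ([ inj₁ , (λ eq → inj₂ (trans (cong c (sym (ℤ.+-assoc p i d))) eq)) ]′ zeros))

    module _ {i : ℤ} (i-arg : IsArg 2r m i)
             (form : ∀ x → power f m x ≡ arg o x 0ℤ ∧ arg o x i ∧ φ x)
             (φ-u : φ (u (m * 2r)) ≡ O)
             (φ-not-u : arg o (u (m * 2r)) 0ℤ ≡ O → φ (map not (u (m * 2r))) ≡ O) where

      -- Where the cell itself is 0, the factor x₀ gives 0. Where it is 1, φ reads an alternating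
      -- block with 1 at index 0, and its value there is 0 by the hypotheses on u and its
      -- complement.
      G-alternating : ∀ {c} → (∀ p → c (p +ℤ 1ℤ) ≡ not (c p)) → ∀ p → G c p ≡ O
      G-alternating {c} alt p with c (p +ℤ 0ℤ) in c₀
      ... | O = G-erodes IsArg-0 i-arg form i (ℤ.+-identityˡ i) c p (inj₁ c₀)
      ... | I = trans (G-form IsArg-0 i-arg form c p) (trans
                  (cong (λ z → c (p +ℤ 0ℤ) ∧ c (p +ℤ i) ∧ z) φ-x) (trans (cong (c (p +ℤ 0ℤ) ∧_) (∧-zeroʳ _)) (∧-zeroʳ _)))
        where
        x = block c (p - + o) (suc (m * 2r))
        φ-x : φ x ≡ O
        φ-x with block-alternating alt (p - + o) (suc (m * 2r))
        ... | b , x≡ with alternating-with-1 x x≡ (trans (arg-block c p IsArg-0) c₀)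
        ... | inj₁ eq            = trans (cong φ eq) φ-u
        ... | inj₂ (eq , u₀≡O) = trans (cong φ eq) (φ-not-u u₀≡O)

corollary4 : ∀ {2r : ℕ} .{{_ : NonZero 2r}} (f : Rule 2r)
    (m : ℕ) .{{_ : NonZero m}} (φ : Vec Bool (suc (m * 2r)) → Bool) →
    let _⟦_⟧ : Vec Bool (suc (m * 2r)) → ℤ → Bool
        x ⟦ k ⟧ = arg (m * ⌈ 2r /2⌉) x k
    in
    ( (∃ λ (i : ℤ) →
         (i ≡ - + 2 ⊎ i ≡ - + 1 ⊎ i ≡ + 1 ⊎ i ≡ + 2) ×
         IsArg 2r m i ×
         (∀ x → power f m x ≡ (x ⟦ 0ℤ ⟧) ∧ (x ⟦ i ⟧) ∧ φ x) ×
         (i ≡ - + 2 ⊎ i ≡ + 2 →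
            φ (u (m * 2r)) ≡ O ×
            -- added hypothesis, see the comment at u
            ((u (m * 2r) ⟦ 0ℤ ⟧) ≡ O → φ (map not (u (m * 2r))) ≡ O)))
    ⊎ (∃ λ (j : ℤ) →
         (- + ⌈ 2r /2⌉ ≤ j × j ≤ + ⌊ 2r /2⌋) ×
         (IsArg 2r m j × IsArg 2r m (j +ℤ 1ℤ)) ×
         (∀ x → power f m x ≡ (x ⟦ j ⟧) ∧ (x ⟦ j +ℤ 1ℤ ⟧) ∧ φ x)) ) →
    f (replicate (suc 2r) O) ≡ O →
    f (replicate (suc 2r) I) ≡ I →
    φ (replicate (suc (m * 2r)) I) ≡ I →
    IsConsensus f ×
    (∀ L .{{_ : NonZero L}} → suc 2r ≤ℕ L →
       Basin (global f L) ｛ replicate L I ｝ ≐ ｛ replicate L I ｝)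
corollary4 {2r} f m φ form f-O f-I _ =
  (λ L _ → attractor⇔ (global-replicate f f-O) (global-replicate f f-I) (global-dichotomy f (vanishes form))) ,
  (λ L _ → basin≐ (global-replicate f f-O) (global-replicate f f-I) (global-dichotomy f (vanishes form)) (replicate-O≢I L))
  where
  vanishes : _ → ∀ {L} .{{_ : NonZero L}} {c} → Periodic L c → ∀ {q} → c q ≡ O → Vanishes (globalℤ f) c
  -- Zeros are tracked under F^m; n steps of F^m are nm steps of F, so vanishing passes to F itself.
  vanishes (inj₂ (j , _ , (j-arg , j+1-arg) , form)) per eq = vanishes-power m f φ
    (vanishes-unit (G-periodic m f φ) 1ℤ (G-erodes m f φ j-arg j+1-arg form 1ℤ refl) refl per eq)
  vanishes (inj₁ (i , i∈ , i-arg , form , φ-zero)) per eq = vanishes-power m f φ (by-cases i∈)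
    where
    erodes : Erodes _ 0ℤ i
    erodes = G-erodes m f φ (IsArg-0 m) i-arg form i (ℤ.+-identityˡ i)
    -- The multiplier `e` will be the sign of `i`.
    double : i ≡ - + 2 ⊎ i ≡ + 2 → ∀ e → e *ℤ i ≡ + 2 → Vanishes _ _
    double ±2 e ei≡2 = vanishes-double (G-periodic m f φ) i e erodes ei≡2
      (G-alternating m f φ i-arg form (proj₁ (φ-zero ±2)) (proj₂ (φ-zero ±2))) per eq
    by-cases : _ → Vanishes _ _
    by-cases (inj₁ refl)               = double (inj₁ refl) (- 1ℤ) refl
    by-cases (inj₂ (inj₁ refl))        = vanishes-unit (G-periodic m f φ) i erodes refl per eq
    by-cases (inj₂ (inj₂ (inj₁ refl))) = vanishes-unit (G-periodic m f φ) i erodes refl per eq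
    by-cases (inj₂ (inj₂ (inj₂ refl))) = double (inj₂ refl) 1ℤ refl
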